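{- Let $n$ be a positive even integer, let $\mathbf{u}=(u_1,\dots,u_n)$ be indeterminates and $\varepsilon=(\varepsilon_1,\dots,\varepsilon_n)\in\{1,-1\}^n$. Let $M^\varepsilon(\mathbf{u})=(m_{ij})_{1\le i,j\le n}$ be the skew-symmetric matrix with, for $i<j$, \[ m_{ij} = \begin{cases} 1 + u_i u_j, &\text{if } \varepsilon_i \varepsilon_j = (-1)^{i+j+1},\\ u_i + u_j, &\text{if } \varepsilon_i \varepsilon_j = (-1)^{i+j}.\end{cases} \] Then \[ \operatorname{Pf} M^\varepsilon(\mathbf{u}) = 2^{n/2-1} \left( \prod_{i:\varepsilon_i = +1} u_i + \prod_{i:\varepsilon_i = -1} u_i \right). \]
   Context: $\operatorname{Pf}$ denotes the Pfaffian of a skew-symmetric matrix; an empty product equals $1$. -}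

module Defs where

open import Level using (Level)
open import Algebra.Bundles using (CommutativeRing)
open import Data.Nat as ℕ using (ℕ; zero; suc)
open import Data.Fin using (Fin; zero; suc; toℕ; punchIn)
open import Data.Sign as Sign using (Sign)
open import Relation.Nullary using (Dec; yes; no)

-- double k = 2k, with double (suc k) = suc (suc (double k)) definitionally
double : ℕ → ℕ
double zero    = zero
double (suc k) = suc (suc (double k))

-- (-1)^k as a sign
signPow : ℕ → Sign
signPow zero    = Sign.+
signPow (suc k) = Sign.opposite (signPow k)

module RingDefs {c ℓ : Level} (R : CommutativeRing c ℓ) where
  open CommutativeRing R using (Carrier; _+_; _*_; -_; 0#; 1#)

  -- finite product over Fin n
  ∏ : (n : ℕ) → (Fin n → Carrier) → Carrier
  ∏ zero    f = 1#
  ∏ (suc n) f = f zero * ∏ n (λ i → f (suc i))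

  -- finite sum over Fin n
  ∑ : (n : ℕ) → (Fin n → Carrier) → Carrier
  ∑ zero    f = 0#
  ∑ (suc n) f = f zero + ∑ n (λ i → f (suc i))

  -- 2^k in the ring
  pow2 : ℕ → Carrier
  pow2 zero    = 1#
  pow2 (suc k) = (1# + 1#) * pow2 k

  -- (-1)^k in the ring
  negOnePow : ℕ → Carrier
  negOnePow zero    = 1#
  negOnePow (suc k) = - negOnePow k

  -- Pfaffian of a (2k)×(2k) matrix, defined by expansion along the first row:
  -- Pf(A) = Σ_{j=2}^{2k} (-1)^j a_{1j} Pf(A with rows/columns 1 and j deleted),
  -- Pf of the empty matrix = 1.
  Pf : (k : ℕ) → (Fin (double k) → Fin (double k) → Carrier) → Carrier
  Pf zero    A = 1#
  Pf (suc k) A =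
    ∑ (suc (double k)) (λ j →
      negOnePow (toℕ j) * (A zero (suc j)
        * Pf k (λ a b → A (suc (punchIn j a)) (suc (punchIn j b)))))

  -- upper-triangular entry m_{ij} (i<j) of M^ε(u); indices 0-based,
  -- parity of i+j is unchanged by the shift to 1-based indices
  entry : {n : ℕ} → (Fin n → Sign) → (Fin n → Carrier) → Fin n → Fin n → Carrier
  entry ε u i j with (ε i Sign.* ε j) Sign.≟ signPow (suc (toℕ i ℕ.+ toℕ j))
  ... | yes _ = 1# + u i * u j
  ... | no  _ = u i + u j

  -- the skew-symmetric matrix M^ε(u)
  M : {n : ℕ} → (Fin n → Sign) → (Fin n → Carrier) → Fin n → Fin n → Carrier
  M ε u i j with toℕ i ℕ.<? toℕ j
  ... | yes _ = entry ε u i j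
  ... | no  _ with toℕ j ℕ.<? toℕ i
  ...   | yes _ = - entry ε u j i
  ...   | no  _ = 0#

  -- ∏_{i : ε_i = s} u_i
  prodSign : {n : ℕ} → Sign → (Fin n → Sign) → (Fin n → Carrier) → Carrier
  prodSign {n} s ε u = ∏ n (λ i → sel (ε i Sign.≟ s) (u i))
    where
    sel : {P : Set} → Dec P → Carrier → Carrier
    sel (yes _) x = x
    sel (no  _) _ = 1#

module Submission where

-- Put δᵢ = εᵢ(-1)ⁱ and let (Xᵢ, Yᵢ) be (uᵢ, 1) or (1, uᵢ) according as δᵢ is + or −.
-- Every entry of M^ε(u) above the diagonal is then XᵢYⱼ + YᵢXⱼ, and for vectors x, y
-- of length 2k+2 the Pfaffian of (xᵢyⱼ + yᵢxⱼ) is 2ᵏ(x₀y₁x₂⋯y₂ₖ₊₁ + y₀x₁y₂⋯x₂ₖ₊₁);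
-- the two alternating products of X and Y are ∏_{εᵢ=+} uᵢ and ∏_{εᵢ=−} uᵢ.
-- The Pfaffian identity follows by expanding along the first row: what remains are
-- signed sums, over a deleted index, of alternating products, and a joint induction
-- shows that for odd length they collapse to a single alternating product.

open import Defs
open import Level using (Level)
open import Algebra.Bundles using (CommutativeRing)
open import Data.Nat as ℕ using (ℕ; zero; suc; z≤n; s≤s)
open import Data.Fin using (Fin; zero; suc; toℕ; punchIn; _<_)
open import Data.Fin.Properties using (<-cmp; <-asym; <-irrefl)
open import Data.Sign as Sign using (Sign; opposite)
open import Data.Sign.Properties
  using (opposite-involutive; opposite[s]*s≡-; s*s≡+; *-commutativeSemigroup)
open import Algebra.Properties.CommutativeSemigroup *-commutativeSemigroup using (interchange)
open import Data.Vec.Functional using (tail)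
open import Function using (_∘_)
open import Data.Maybe using (nothing)
open import Relation.Nullary using (yes; no; contradiction)
open import Relation.Binary.Definitions using (tri<; tri≈; tri>)
open import Relation.Binary.PropositionalEquality as ≡ using (_≡_; _≢_; refl; cong)
open import Tactic.RingSolver.Core.AlmostCommutativeRing using (fromCommutativeRing)

*-opposite : ∀ s t → s Sign.* opposite t ≡ opposite (s Sign.* t)
*-opposite Sign.+ t = refl
*-opposite Sign.- t = refl

opposite-* : ∀ s t → opposite (s Sign.* t) ≡ opposite s Sign.* t
opposite-* Sign.+ t = refl
opposite-* Sign.- t = opposite-involutive t

*-*-opposite : ∀ a s t → a Sign.* (s Sign.* opposite t) ≡ opposite (a Sign.* (s Sign.* t))
*-*-opposite a s t = ≡.trans (cong (a Sign.*_) (*-opposite s t)) (*-opposite a (s Sign.* t))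

≢opposite⇒≡ : ∀ {s t} → s ≢ opposite t → s ≡ t
≢opposite⇒≡ {Sign.+} {Sign.+} _ = refl
≢opposite⇒≡ {Sign.-} {Sign.-} _ = refl
≢opposite⇒≡ {Sign.+} {Sign.-} s≢t = contradiction refl s≢t
≢opposite⇒≡ {Sign.-} {Sign.+} s≢t = contradiction refl s≢t

signPow-+ : ∀ m n → signPow (m ℕ.+ n) ≡ signPow m Sign.* signPow n
signPow-+ zero    n = refl
signPow-+ (suc m) n = ≡.trans (cong opposite (signPow-+ m n)) (opposite-* (signPow m) (signPow n))

punchIn-mono-< : ∀ {n} (j : Fin (suc n)) {a b : Fin n} → a < b → punchIn j a < punchIn j b
punchIn-mono-< zero    a<b = s≤s a<b
punchIn-mono-< (suc j) {zero}  {suc b} _         = s≤s z≤n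
punchIn-mono-< (suc j) {suc a} {suc b} (s≤s a<b) = s≤s (punchIn-mono-< j a<b)

module Pfaffian {c ℓ : Level} (R : CommutativeRing c ℓ) where
  open CommutativeRing R hiding (zero) renaming (refl to ≈-refl)
  open RingDefs R
  open import Algebra.Properties.Ring ring
    using (-‿distribˡ-*; -0#≈0#; x[y-z]≈xy-xz; ⁻¹-anti-homo‿-; xyx⁻¹≈y)
  open import Relation.Binary.Reasoning.Setoid setoid
  open import Tactic.RingSolver.NonReflective (fromCommutativeRing R (λ _ → nothing))
  import Algebra.Solver.Ring.NaturalCoefficients.Default commutativeSemiring as SemiringSolver

  skew : ∀ {n} → (Fin n → Fin n → Carrier) → Fin n → Fin n → Carrier
  skew f i j with toℕ i ℕ.<? toℕ j
  ... | yes _ = f i j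
  ... | no  _ with toℕ j ℕ.<? toℕ i
  ...   | yes _ = - f j i
  ...   | no  _ = 0#

  skew-< : ∀ {n} (f : Fin n → Fin n → Carrier) {i j} → i < j → skew f i j ≡ f i j
  skew-< f {i} {j} i<j with toℕ i ℕ.<? toℕ j
  ... | yes _   = refl
  ... | no  i≮j = contradiction i<j i≮j

  skew-> : ∀ {n} (f : Fin n → Fin n → Carrier) {i j} → j < i → skew f i j ≡ - f j i
  skew-> f {i} {j} j<i with toℕ i ℕ.<? toℕ j
  ... | yes i<j = contradiction j<i (<-asym i<j)
  ... | no  _ with toℕ j ℕ.<? toℕ i
  ...   | yes _   = refl
  ...   | no  j≮i = contradiction j<i j≮i

  skew-diag : ∀ {n} (f : Fin n → Fin n → Carrier) i → skew f i i ≡ 0#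
  skew-diag f i with toℕ i ℕ.<? toℕ i
  ... | yes i<i = contradiction i<i (<-irrefl refl)
  ... | no  _ with toℕ i ℕ.<? toℕ i
  ...   | yes i<i = contradiction i<i (<-irrefl refl)
  ...   | no  _   = refl

  skew-reindex : ∀ {m n} (ρ : Fin m → Fin n) → (∀ {a b} → a < b → ρ a < ρ b) →
                 ∀ f a b → skew f (ρ a) (ρ b) ≡ skew (λ a b → f (ρ a) (ρ b)) a b
  skew-reindex ρ ρ-mono f a b with <-cmp a b
  ... | tri< a<b _ _ = ≡.trans (skew-< f (ρ-mono a<b)) (≡.sym (skew-< _ a<b))
  ... | tri> _ _ b<a = ≡.trans (skew-> f (ρ-mono b<a)) (≡.sym (skew-> _ b<a))
  ... | tri≈ _ refl _ = ≡.trans (skew-diag f (ρ a)) (≡.sym (skew-diag _ a))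

  skew-cong : ∀ {n} {f g : Fin n → Fin n → Carrier} → (∀ i j → f i j ≈ g i j) →
              ∀ i j → skew f i j ≈ skew g i j
  skew-cong f≈g i j with toℕ i ℕ.<? toℕ j
  ... | yes _ = f≈g i j
  ... | no  _ with toℕ j ℕ.<? toℕ i
  ...   | yes _ = -‿cong (f≈g j i)
  ...   | no  _ = ≈-refl

  M≡skew-entry : ∀ {n} (ε : Fin n → Sign) u i j → M ε u i j ≡ skew (entry ε u) i j
  M≡skew-entry ε u i j with toℕ i ℕ.<? toℕ j
  ... | yes _ = refl
  ... | no  _ with toℕ j ℕ.<? toℕ i
  ...   | yes _ = refl
  ...   | no  _ = refl

  ∑-cong : ∀ n {f g : Fin n → Carrier} → (∀ i → f i ≈ g i) → ∑ n f ≈ ∑ n g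
  ∑-cong zero    f≈g = ≈-refl
  ∑-cong (suc n) f≈g = +-cong (f≈g zero) (∑-cong n (f≈g ∘ suc))

  ∑-distrib-+ : ∀ n (f g : Fin n → Carrier) → ∑ n (λ i → f i + g i) ≈ ∑ n f + ∑ n g
  ∑-distrib-+ zero    f g = sym (+-identityʳ 0#)
  ∑-distrib-+ (suc n) f g = begin
    (f zero + g zero) + ∑ n (λ i → f (suc i) + g (suc i))
      ≈⟨ +-congˡ (∑-distrib-+ n (tail f) (tail g)) ⟩
    (f zero + g zero) + (∑ n (tail f) + ∑ n (tail g))
      ≈⟨ solve 4 (λ a b s t → ((a ⊕ b) ⊕ (s ⊕ t)) ⊜ ((a ⊕ s) ⊕ (b ⊕ t))) ≈-refl _ _ _ _ ⟩
    (f zero + ∑ n (tail f)) + (g zero + ∑ n (tail g)) ∎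

  *-distribˡ-∑ : ∀ n a (f : Fin n → Carrier) → a * ∑ n f ≈ ∑ n (λ i → a * f i)
  *-distribˡ-∑ zero    a f = zeroʳ a
  *-distribˡ-∑ (suc n) a f = trans (distribˡ a _ _) (+-congˡ (*-distribˡ-∑ n a (tail f)))

  ∑-bilinear : ∀ n p a b (f g : Fin n → Carrier) →
               ∑ n (λ j → p * (a * f j + b * g j)) ≈ p * (a * ∑ n f + b * ∑ n g)
  ∑-bilinear n p a b f g = begin
    ∑ n (λ j → p * (a * f j + b * g j))         ≈⟨ *-distribˡ-∑ n p _ ⟨
    p * ∑ n (λ j → a * f j + b * g j)           ≈⟨ *-congˡ (∑-distrib-+ n _ _) ⟩
    p * (∑ n (λ j → a * f j) + ∑ n (λ j → b * g j))
      ≈⟨ *-congˡ (+-cong (*-distribˡ-∑ n a f) (*-distribˡ-∑ n b g)) ⟨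
    p * (a * ∑ n f + b * ∑ n g)                 ∎

  Pf-cong : ∀ k {A B : Fin (double k) → Fin (double k) → Carrier} →
            (∀ a b → A a b ≈ B a b) → Pf k A ≈ Pf k B
  Pf-cong zero    A≈B = ≈-refl
  Pf-cong (suc k) {A} {B} A≈B = ∑-cong _ λ j →
    *-cong (≈-refl {negOnePow (toℕ j)}) (*-cong (A≈B zero (suc j))
      (Pf-cong k {minor A j} {minor B j} λ a b → A≈B (suc (punchIn j a)) (suc (punchIn j b))))
    where
    minor : (Fin (double (suc k)) → Fin (double (suc k)) → Carrier) → Fin (suc (double k)) →
            Fin (double k) → Fin (double k) → Carrier
    minor C j a b = C (suc (punchIn j a)) (suc (punchIn j b))

  altProd : ∀ n → (Fin n → Carrier) → (Fin n → Carrier) → Carrier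
  altProd zero    x y = 1#
  altProd (suc n) x y = x zero * altProd n (tail y) (tail x)

  altProd-cong : ∀ n {x x′ y y′ : Fin n → Carrier} →
                 (∀ i → x i ≈ x′ i) → (∀ i → y i ≈ y′ i) → altProd n x y ≈ altProd n x′ y′
  altProd-cong zero    x≈x′ y≈y′ = ≈-refl
  altProd-cong (suc n) x≈x′ y≈y′ = *-cong (x≈x′ zero) (altProd-cong n (y≈y′ ∘ suc) (x≈x′ ∘ suc))

  deletionTerm : ∀ m → (z x y : Fin (suc m) → Carrier) → Fin (suc m) → Carrier
  deletionTerm m z x y j = negOnePow (toℕ j) * (z j * altProd m (x ∘ punchIn j) (y ∘ punchIn j))

  deletionSum : ∀ m → (z x y : Fin (suc m) → Carrier) → Carrier
  deletionSum m z x y = ∑ (suc m) (deletionTerm m z x y)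

  -- Deleting an index j ≥ 1 keeps x₀ in front and swaps the roles of x and y behind it.
  deletionSum-suc : ∀ m (z x y : Fin (suc (suc m)) → Carrier) →
    deletionSum (suc m) z x y ≈
      z zero * altProd (suc m) (tail x) (tail y) - x zero * deletionSum m (tail z) (tail y) (tail x)
  deletionSum-suc m z x y = begin
    1# * h + ∑ (suc m) (λ j → - n j * (z (suc j) * (x zero * a j)))
      ≈⟨ +-cong (*-identityˡ h) (∑-cong (suc m) λ j → move-sign (n j) (z (suc j)) (x zero) (a j)) ⟩
    h + ∑ (suc m) (λ j → - x zero * t j)  ≈⟨ +-congˡ (*-distribˡ-∑ (suc m) (- x zero) t) ⟨
    h + - x zero * ∑ (suc m) t            ≈⟨ +-congˡ (-‿distribˡ-* (x zero) (∑ (suc m) t)) ⟨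
    h - x zero * ∑ (suc m) t              ∎
    where
    h : Carrier
    h = z zero * altProd (suc m) (tail x) (tail y)
    t n a : Fin (suc m) → Carrier
    t = deletionTerm m (tail z) (tail y) (tail x)
    n j = negOnePow (toℕ j)
    a j = altProd m (tail y ∘ punchIn j) (tail x ∘ punchIn j)
    move-sign : ∀ n z x a → - n * (z * (x * a)) ≈ - x * (n * (z * a))
    move-sign = solve 4 (λ n z x a → ((⊝ n) ⊗ (z ⊗ (x ⊗ a))) ⊜ ((⊝ x) ⊗ (n ⊗ (z ⊗ a)))) ≈-refl

  deletionSum-odd-yxy  : ∀ k (x y : Fin (suc (double k)) → Carrier) →
                         deletionSum (double k) y x y ≈ altProd _ y x
  deletionSum-odd-yyx  : ∀ k (x y : Fin (suc (double k)) → Carrier) →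
                         deletionSum (double k) y y x ≈ altProd _ y x
  deletionSum-even-yxy : ∀ k (x y : Fin (suc (suc (double k))) → Carrier) →
                         deletionSum (suc (double k)) y x y ≈ altProd _ y x - altProd _ x y
  deletionSum-even-yyx : ∀ k (x y : Fin (suc (suc (double k))) → Carrier) →
                         deletionSum (suc (double k)) y y x ≈ 0#

  deletionSum-odd-yxy zero x y = trans (+-identityʳ _) (*-identityˡ _)
  deletionSum-odd-yxy (suc k) x y = begin
    deletionSum (suc (suc (double k))) y x y
      ≈⟨ deletionSum-suc _ y x y ⟩
    y zero * altProd _ (tail x) (tail y) - x zero * deletionSum _ (tail y) (tail y) (tail x)
      ≈⟨ +-congˡ (-‿cong (trans (*-congˡ (deletionSum-even-yyx k (tail x) (tail y))) (zeroʳ _))) ⟩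
    y zero * altProd _ (tail x) (tail y) - 0#
      ≈⟨ trans (+-congˡ -0#≈0#) (+-identityʳ _) ⟩
    altProd _ y x ∎

  deletionSum-odd-yyx zero x y = trans (+-identityʳ _) (*-identityˡ _)
  deletionSum-odd-yyx (suc k) x y = begin
    deletionSum (suc (suc (double k))) y y x
      ≈⟨ deletionSum-suc _ y y x ⟩
    y zero * a - y zero * deletionSum _ (tail y) (tail x) (tail y)
      ≈⟨ +-congˡ (-‿cong (*-congˡ (deletionSum-even-yxy k (tail x) (tail y)))) ⟩
    y zero * a - y zero * (a - b)
      ≈⟨ +-congˡ (-‿cong (x[y-z]≈xy-xz (y zero) a b)) ⟩
    y zero * a - (y zero * a - y zero * b)
      ≈⟨ +-congˡ (⁻¹-anti-homo‿- _ _) ⟩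
    y zero * a + (y zero * b - y zero * a)
      ≈⟨ trans (sym (+-assoc _ _ _)) (xyx⁻¹≈y _ _) ⟩
    altProd _ y x ∎
    where
    a b : Carrier
    a = altProd _ (tail y) (tail x)
    b = altProd _ (tail x) (tail y)

  deletionSum-even-yxy k x y = trans (deletionSum-suc _ y x y)
    (+-congˡ (-‿cong (*-congˡ (deletionSum-odd-yyx k (tail x) (tail y)))))

  deletionSum-even-yyx k x y = trans (deletionSum-suc _ y y x)
    (trans (+-congˡ (-‿cong (*-congˡ (deletionSum-odd-yxy k (tail x) (tail y))))) (-‿inverseʳ _))

  cross : ∀ {n} → (x y : Fin n → Carrier) → Fin n → Fin n → Carrier
  cross x y i j = x i * y j + y i * x j

  Pf-skew-cross : ∀ k (x y : Fin (double (suc k)) → Carrier) →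
                  Pf (suc k) (skew (cross x y)) ≈ pow2 k * (altProd _ x y + altProd _ y x)
  Pf-skew-cross zero x y = SemiringSolver.solve 4 (λ x₀ x₁ y₀ y₁ →
    con 1 :* ((x₀ :* y₁ :+ y₀ :* x₁) :* con 1) :+ con 0 :=
    con 1 :* (x₀ :* (y₁ :* con 1) :+ y₀ :* (x₁ :* con 1))) ≈-refl _ _ _ _
    where open SemiringSolver using (_:=_; _:+_; _:*_; con)
  Pf-skew-cross (suc k) x y = begin
    Pf (suc (suc k)) (skew (cross x y))
      ≈⟨ ∑-cong m expand-row ⟩
    ∑ m (λ j → pow2 k * (x zero * paired X Y j + y zero * paired Y X j))
      ≈⟨ ∑-bilinear m (pow2 k) (x zero) (y zero) (paired X Y) (paired Y X) ⟩
    pow2 k * (x zero * ∑ m (paired X Y) + y zero * ∑ m (paired Y X))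
      ≈⟨ *-congˡ (+-cong (*-congˡ (∑-paired X Y)) (*-congˡ (∑-paired Y X))) ⟩
    pow2 k * (x zero * (altProd m Y X + altProd m Y X) + y zero * (altProd m X Y + altProd m X Y))
      ≈⟨ SemiringSolver.solve 5 (λ p x₀ y₀ a b →
           p :* (x₀ :* (a :+ a) :+ y₀ :* (b :+ b)) := (con 1 :+ con 1) :* p :* (x₀ :* a :+ y₀ :* b))
           ≈-refl _ _ _ _ _ ⟩
    pow2 (suc k) * (altProd _ x y + altProd _ y x) ∎
    where
    open SemiringSolver using (_:=_; _:+_; _:*_; con)
    m : ℕ
    m = suc (double (suc k))
    X Y : Fin m → Carrier
    X = tail x
    Y = tail y
    paired : (a b : Fin m → Carrier) → Fin m → Carrier
    paired a b j = deletionTerm _ b a b j + deletionTerm _ b b a j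

    ∑-paired : ∀ a b → ∑ m (paired a b) ≈ altProd m b a + altProd m b a
    ∑-paired a b = trans (∑-distrib-+ m (deletionTerm _ b a b) (deletionTerm _ b b a))
      (+-cong (deletionSum-odd-yxy (suc k) a b) (deletionSum-odd-yyx (suc k) a b))

    expand-row : ∀ j → negOnePow (toℕ j) * (skew (cross x y) zero (suc j) *
                   Pf (suc k) (λ a b → skew (cross x y) (suc (punchIn j a)) (suc (punchIn j b)))) ≈
                 pow2 k * (x zero * paired X Y j + y zero * paired Y X j)
    expand-row j = begin
      n * (skew (cross x y) zero (suc j) * Pf (suc k) minor)
        ≈⟨ *-congˡ (*-cong (reflexive (skew-< (cross x y) (s≤s z≤n))) (Pf-cong (suc k) minor≈)) ⟩
      n * ((x zero * Y j + y zero * X j) * Pf (suc k) (skew (cross X′ Y′)))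
        ≈⟨ *-congˡ (*-congˡ (Pf-skew-cross k X′ Y′)) ⟩
      n * ((x zero * Y j + y zero * X j) * (pow2 k * (a + b)))
        ≈⟨ SemiringSolver.solve 8 (λ n x₀ y₀ Yⱼ Xⱼ a b p →
             n :* ((x₀ :* Yⱼ :+ y₀ :* Xⱼ) :* (p :* (a :+ b))) :=
             p :* (x₀ :* (n :* (Yⱼ :* a) :+ n :* (Yⱼ :* b)) :+ y₀ :* (n :* (Xⱼ :* b) :+ n :* (Xⱼ :* a))))
             ≈-refl _ _ _ _ _ _ _ _ ⟩
      pow2 k * (x zero * paired X Y j + y zero * paired Y X j) ∎
      where
      X′ Y′ : Fin (double (suc k)) → Carrier
      X′ = X ∘ punchIn j
      Y′ = Y ∘ punchIn j
      minor : Fin (double (suc k)) → Fin (double (suc k)) → Carrier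
      minor a b = skew (cross x y) (suc (punchIn j a)) (suc (punchIn j b))
      minor≈ : ∀ a b → minor a b ≈ skew (cross X′ Y′) a b
      minor≈ a b = reflexive (skew-reindex (suc ∘ punchIn j) (s≤s ∘ punchIn-mono-< j) (cross x y) a b)
      n a b : Carrier
      n = negOnePow (toℕ j)
      a = altProd _ X′ Y′
      b = altProd _ Y′ X′

  keep drop : Sign → Carrier → Carrier
  keep Sign.+ v = v
  keep Sign.- v = 1#
  drop Sign.+ v = 1#
  drop Sign.- v = v

  keep-opposite : ∀ d v → keep (opposite d) v ≡ drop d v
  keep-opposite Sign.+ v = refl
  keep-opposite Sign.- v = refl

  drop-opposite : ∀ d v → drop (opposite d) v ≡ keep d v
  drop-opposite Sign.+ v = refl
  drop-opposite Sign.- v = refl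

  keep-flip : ∀ a s t v → keep (a Sign.* (s Sign.* opposite t)) v ≡ drop (a Sign.* (s Sign.* t)) v
  keep-flip a s t v =
    ≡.trans (cong (λ d → keep d v) (*-*-opposite a s t)) (keep-opposite (a Sign.* (s Sign.* t)) v)

  drop-flip : ∀ a s t v → drop (a Sign.* (s Sign.* opposite t)) v ≡ keep (a Sign.* (s Sign.* t)) v
  drop-flip a s t v =
    ≡.trans (cong (λ d → drop d v) (*-*-opposite a s t)) (drop-opposite (a Sign.* (s Sign.* t)) v)

  cross-keep-drop-unlike : ∀ d e v w → d Sign.* e ≡ Sign.- →
                           1# + v * w ≈ keep d v * drop e w + drop d v * keep e w
  cross-keep-drop-unlike Sign.+ Sign.- v w _ = trans (+-comm _ _) (+-congˡ (sym (*-identityˡ 1#)))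
  cross-keep-drop-unlike Sign.- Sign.+ v w _ = +-congʳ (sym (*-identityˡ 1#))

  cross-keep-drop-alike : ∀ d e v w → d Sign.* e ≡ Sign.+ →
                          v + w ≈ keep d v * drop e w + drop d v * keep e w
  cross-keep-drop-alike Sign.+ Sign.+ v w _ = sym (+-cong (*-identityʳ v) (*-identityˡ w))
  cross-keep-drop-alike Sign.- Sign.- v w _ =
    trans (+-comm v w) (sym (+-cong (*-identityˡ w) (*-identityʳ v)))

  -- The sign s absorbs the parity shift signPow (suc i) = opposite (signPow i) in the tail.
  altProd-keep-drop : ∀ n (ε : Fin n → Sign) u s →
    altProd n (λ i → keep (ε i Sign.* (s Sign.* signPow (toℕ i))) (u i))
              (λ i → drop (ε i Sign.* (s Sign.* signPow (toℕ i))) (u i)) ≈ prodSign s ε u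
  altProd-keep-drop-tail : ∀ n (ε : Fin (suc n) → Sign) u s →
    altProd n (λ i → drop (ε (suc i) Sign.* (s Sign.* opposite (signPow (toℕ i)))) (u (suc i)))
              (λ i → keep (ε (suc i) Sign.* (s Sign.* opposite (signPow (toℕ i)))) (u (suc i)))
      ≈ prodSign s (tail ε) (tail u)

  altProd-keep-drop zero    ε u s = ≈-refl
  altProd-keep-drop (suc n) ε u Sign.+ with ε zero
  ... | Sign.+ = *-congˡ (altProd-keep-drop-tail n ε u Sign.+)
  ... | Sign.- = *-congˡ (altProd-keep-drop-tail n ε u Sign.+)
  altProd-keep-drop (suc n) ε u Sign.- with ε zero
  ... | Sign.+ = *-congˡ (altProd-keep-drop-tail n ε u Sign.-)
  ... | Sign.- = *-congˡ (altProd-keep-drop-tail n ε u Sign.-)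

  altProd-keep-drop-tail n ε u s = trans
    (altProd-cong n (λ i → reflexive (drop-flip (ε (suc i)) s (signPow (toℕ i)) (u (suc i))))
                    (λ i → reflexive (keep-flip (ε (suc i)) s (signPow (toℕ i)) (u (suc i)))))
    (altProd-keep-drop n (tail ε) (tail u) s)

  module _ {n} (ε : Fin n → Sign) (u : Fin n → Carrier) where

    δ : Fin n → Sign
    δ i = ε i Sign.* signPow (toℕ i)

    X Y : Fin n → Carrier
    X i = keep (δ i) (u i)
    Y i = drop (δ i) (u i)

    δ-* : ∀ i j → δ i Sign.* δ j ≡ (ε i Sign.* ε j) Sign.* signPow (toℕ i ℕ.+ toℕ j)
    δ-* i j = ≡.trans (interchange (ε i) _ (ε j) _)
                      (cong ((ε i Sign.* ε j) Sign.*_) (≡.sym (signPow-+ (toℕ i) (toℕ j))))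

    entry≈cross : ∀ i j → entry ε u i j ≈ cross X Y i j
    entry≈cross i j with (ε i Sign.* ε j) Sign.≟ signPow (suc (toℕ i ℕ.+ toℕ j))
    ... | yes p = cross-keep-drop-unlike (δ i) (δ j) (u i) (u j)
                    (≡.trans (δ-* i j) (≡.trans (cong (Sign._* t) p) (opposite[s]*s≡- t)))
      where t = signPow (toℕ i ℕ.+ toℕ j)
    ... | no ¬p = cross-keep-drop-alike (δ i) (δ j) (u i) (u j)
                    (≡.trans (δ-* i j) (≡.trans (cong (Sign._* t) (≢opposite⇒≡ ¬p)) (s*s≡+ t)))
      where t = signPow (toℕ i ℕ.+ toℕ j)

    M≈skew-cross : ∀ i j → M ε u i j ≈ skew (cross X Y) i j
    M≈skew-cross i j = trans (reflexive (M≡skew-entry ε u i j)) (skew-cong entry≈cross i j)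

    altProd-XY : altProd n X Y ≈ prodSign Sign.+ ε u
    altProd-XY = altProd-keep-drop n ε u Sign.+

    altProd-YX : altProd n Y X ≈ prodSign Sign.- ε u
    altProd-YX = trans
      (altProd-cong n (λ i → reflexive (≡.sym (keep-flip (ε i) Sign.+ (signPow (toℕ i)) (u i))))
                      (λ i → reflexive (≡.sym (drop-flip (ε i) Sign.+ (signPow (toℕ i)) (u i)))))
      (altProd-keep-drop n ε u Sign.-)

lemma3p6 : {c ℓ : Level} (R : CommutativeRing c ℓ) (k : ℕ)
    (ε : Fin (double (suc k)) → Sign) (u : Fin (double (suc k)) → CommutativeRing.Carrier R) →
    let open CommutativeRing R
        open RingDefs R
    in Pf (suc k) (M ε u) ≈ pow2 k * (prodSign Sign.+ ε u + prodSign Sign.- ε u)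
lemma3p6 R k ε u = begin
  Pf (suc k) (M ε u)                                    ≈⟨ Pf-cong (suc k) (M≈skew-cross ε u) ⟩
  Pf (suc k) (skew (cross (X ε u) (Y ε u)))             ≈⟨ Pf-skew-cross k (X ε u) (Y ε u) ⟩
  pow2 k * (altProd _ (X ε u) (Y ε u) + altProd _ (Y ε u) (X ε u))
    ≈⟨ *-congˡ (+-cong (altProd-XY ε u) (altProd-YX ε u)) ⟩
  pow2 k * (prodSign Sign.+ ε u + prodSign Sign.- ε u)  ∎
  where
  open CommutativeRing R
  open RingDefs R
  open Pfaffian R
  open import Relation.Binary.Reasoning.Setoid setoid
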